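{- Let $\phi$ be an LTL formula. Then there exists a term $\mathsf{t}_{\mathbb{S}}$ of the Linear Time $\nu$-calculus such that $\Gamma_{\mathbb{S}}([\![\phi]\!])=[\![\mathsf{t}_{\mathbb{S}}]\!]$.
   Context: Let $\mathcal{E}$ be a set of events, $AP$ a countable set of atomic propositions and $\langle\!\langle -\rangle\!\rangle:AP\to\wp(\mathcal{E})$ an interpretation. $\mathcal{E}^\omega$ is the set of infinite traces; for $w\in\mathcal{E}^\omega$, $w_i$ is its $i$-th element (from $0$) and $w_{\geq i}$ the suffix starting at $w_i$. LTL formulas: $\phi,\psi::=\top\mid\bot\mid p\mid p^\bot\mid\phi\wedge\psi\mid\phi\vee\psi\mid\phi\,\mathcal{U}\,\psi\mid\phi\,\mathcal{R}\,\psi\mid\circ\phi$ with $p\in AP$. Semantics: $w,i\models_L\top$ always and $w,i\models_L\bot$ never; $w,i\models_L p$ iff $w_i\in\langle\!\langle p\rangle\!\rangle$; $w,i\models_L p^\bot$ iff $w_i\notin\langle\!\langle p\rangle\!\rangle$; $\wedge,\vee$ as conjunction and disjunction; $w,i\models_L\phi\,\mathcal{U}\,\psi$ iff there is $k\ge i$ with $w,k\models_L\psi$ and $w,l\models_L\phi$ for all $i\le l<k$; $w,i\models_L\phi\,\mathcal{R}\,\psi$ iff either $w,k\models_L\psi$ for all $k\ge i$, or there is $k\ge i$ with $w,k\models_L\phi$ and $w,l\models_L\psi$ for all $i\le l\le k$; $w,i\models_L\circ\phi$ iff $w,i+1\models_L\phi$. Set $[\![\phi]\!]=\{w\in\mathcal{E}^\omega\mid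 w,0\models_L\phi\}$. Terms of the Linear Time $\nu$-calculus (LT$\nu$) are inductively generated by $\mathsf{t},\mathsf{s}::=\top\mid\bot\mid p\mid p^\bot\mid\mathsf{t}\wedge\mathsf{s}\mid\mathsf{t}\vee\mathsf{s}\mid\circ\mathsf{t}\mid X\mid\nu X.\mathsf{t}$, with $p\in AP$ and $X$ a variable bound by $\nu X$. The relation $w\models_C\mathsf{t}$ is the coinductive interpretation (greatest relation, i.e. possibly infinite derivations) of the rules: $w\models_C\top$; $w\models_C p$ if $w_0\in\langle\!\langle p\rangle\!\rangle$; $w\models_C p^\bot$ if $w_0\notin\langle\!\langle p\rangle\!\rangle$; $w\models_C\circ\mathsf{t}$ from $w_{\geq1}\models_C\mathsf{t}$; $w\models_C\mathsf{t}\vee\mathsf{s}$ from $w\models_C\mathsf{t}$, or from $w\models_C\mathsf{s}$; $w\models_C\mathsf{t}\wedge\mathsf{s}$ from $w\models_C\mathsf{t}$ and $w\models_C\mathsf{s}$; $w\models_C\nu X.\mathsf{t}$ from $w\models_C\mathsf{t}\{\nu X.\mathsf{t}/X\}$ (capture-avoiding substitution). There is no rule for $\bot$ nor for a variable. Set $[\![\mathsf{t}]\!]=\{w\in\mathcal{E}^\omega\mid w\models_C\mathsf{t}\}$. A property $P\subseteq\mathcal{E}^\omega$ is a safety property if every $w\in\mathcal{E}^\omega\setminus P$ has a finite prefix $u$ such that no infinite trace with prefix $u$ belongs to $P$. $\Gamma_{\mathbb{S}}(P)$ denotes the intersection of all safety properties $Q\subseteq\mathcal{E}^\omega$ with $P\subseteq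 Q$. -}

module Defs where

open import Axiom.ExcludedMiddle using (ExcludedMiddle)
import Data.Empty as Empty
open import Data.Fin.Base using (Fin)
open import Data.Fin.Substitution using (Lift; Sub; TermSubst)
open import Data.List.Base using (List; applyUpTo; length)
open import Data.Nat.Base using (ℕ; suc; _+_; _≤_; _<_)
open import Data.Product.Base using (_×_; ∃-syntax; Σ-syntax)
open import Data.Sum.Base using (_⊎_)
import Data.Unit.Base as Unit
open import Data.Vec.Base using (lookup)
open import Function.Bundles using (_↣_)
open import Level using (Setω; 0ℓ)
import Level
open import Relation.Binary.PropositionalEquality.Core using (_≡_)
open import Relation.Unary using (Pred; _∈_; _∉_; _⊆_)

private
  variable
    E AP : Set
    m n : ℕ

-- The mathematics is classical. Excluded middle at every level also makes
-- every proposition equivalent to one in Set, so quantifying over Set-valued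
-- predicates and relations below is quantifying over all of them.

Classical : Setω
Classical = ∀ {ℓ} → ExcludedMiddle ℓ

-- Finite or countably infinite.

Countable : Set → Set
Countable A = A ↣ ℕ

Trace : Set → Set
Trace E = ℕ → E

suffix : Trace E → ℕ → Trace E
suffix w i = λ j → w (i + j)

Property : Set → Set₁
Property E = Pred (Trace E) 0ℓ

_isPrefixOf_ : List E → Trace E → Set
u isPrefixOf w = applyUpTo w (length u) ≡ u

Safety : Property E → Set
Safety {E} P =
  ∀ w → w ∉ P →
  ∃[ u ] (u isPrefixOf w × (∀ (w′ : Trace E) → u isPrefixOf w′ → w′ ∉ P))

Γ𝕊 : Property E → Pred (Trace E) (Level.suc 0ℓ)
Γ𝕊 {E} P w = (Q : Property E) → Safety Q → P ⊆ Q → w ∈ Q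

infix  9 _ᗮ
infixr 8 ○_
infixr 7 _𝓤_ _𝓡_
infixr 6 _∧_
infixr 5 _∨_

data LTL (AP : Set) : Set where
  ⊤ ⊥     : LTL AP
  atom _ᗮ : AP → LTL AP
  _∧_ _∨_ : LTL AP → LTL AP → LTL AP
  _𝓤_ _𝓡_ : LTL AP → LTL AP → LTL AP
  ○_      : LTL AP → LTL AP

-- Well-scoped de Bruijn syntax: Term AP n has at most n free variables, ν binds
-- variable zero, and the terms of the calculus are those in Term AP 0.

data Term (AP : Set) (n : ℕ) : Set where
  ⊤ ⊥     : Term AP n
  atom _ᗮ : AP → Term AP n
  _∧_ _∨_ : Term AP n → Term AP n → Term AP n
  ○_      : Term AP n → Term AP n
  var     : Fin n → Term AP n
  ν       : Term AP (suc n) → Term AP n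

module TermApp {T : ℕ → Set} (l : Lift T (Term AP)) where
  open Lift l using (lift; _↑)

  infixl 8 _/_

  _/_ : Term AP m → Sub T m n → Term AP n
  ⊤       / ρ = ⊤
  ⊥       / ρ = ⊥
  atom p  / ρ = atom p
  (p ᗮ)   / ρ = p ᗮ
  (t ∧ s) / ρ = (t / ρ) ∧ (s / ρ)
  (t ∨ s) / ρ = (t / ρ) ∨ (s / ρ)
  (○ t)   / ρ = ○ (t / ρ)
  var x   / ρ = lift (lookup ρ x)
  ν t     / ρ = ν (t / (ρ ↑))

termSubst : TermSubst (Term AP)
termSubst = record { var = var ; app = TermApp._/_ }

infix 10 _[_]

_[_] : Term AP (suc n) → Term AP n → Term AP n
_[_] {AP} t s = t / sub s
  where open TermSubst (termSubst {AP}) using (_/_; sub)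

module Semantics {E AP : Set} (⟪_⟫ : AP → Pred E 0ℓ) where

  infix 4 _⊨L[_]_ _⊨C_

  _⊨L[_]_ : Trace E → ℕ → LTL AP → Set
  w ⊨L[ i ] ⊤      = Unit.⊤
  w ⊨L[ i ] ⊥      = Empty.⊥
  w ⊨L[ i ] atom p = w i ∈ ⟪ p ⟫
  w ⊨L[ i ] p ᗮ    = w i ∉ ⟪ p ⟫
  w ⊨L[ i ] φ ∧ ψ  = w ⊨L[ i ] φ × w ⊨L[ i ] ψ
  w ⊨L[ i ] φ ∨ ψ  = w ⊨L[ i ] φ ⊎ w ⊨L[ i ] ψ
  w ⊨L[ i ] φ 𝓤 ψ  =
    ∃[ k ] (i ≤ k × w ⊨L[ k ] ψ × (∀ l → i ≤ l → l < k → w ⊨L[ l ] φ))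
  w ⊨L[ i ] φ 𝓡 ψ  =
    (∀ k → i ≤ k → w ⊨L[ k ] ψ) ⊎
    (∃[ k ] (i ≤ k × w ⊨L[ k ] φ × (∀ l → i ≤ l → l ≤ k → w ⊨L[ l ] ψ)))
  w ⊨L[ i ] ○ φ    = w ⊨L[ suc i ] φ

  ⟦_⟧L : LTL AP → Property E
  ⟦ φ ⟧L w = w ⊨L[ 0 ] φ

  -- Rule R w t: the judgement (w , t) is the conclusion of a rule instance whose
  -- premises all lie in R.

  data Rule (R : Trace E → Term AP 0 → Set) (w : Trace E) : Term AP 0 → Set where
    ⊤-rule    : Rule R w ⊤
    atom-rule : ∀ {p} → w 0 ∈ ⟪ p ⟫ → Rule R w (atom p)
    ᗮ-rule    : ∀ {p} → w 0 ∉ ⟪ p ⟫ → Rule R w (p ᗮ)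
    ○-rule    : ∀ {t} → R (suffix w 1) t → Rule R w (○ t)
    ∨-ruleˡ   : ∀ {t s} → R w t → Rule R w (t ∨ s)
    ∨-ruleʳ   : ∀ {t s} → R w s → Rule R w (t ∨ s)
    ∧-rule    : ∀ {t s} → R w t → R w s → Rule R w (t ∧ s)
    ν-rule    : ∀ {t} → R w (t [ ν t ]) → Rule R w (ν t)

  Consistent : (Trace E → Term AP 0 → Set) → Set
  Consistent R = ∀ {w t} → R w t → Rule R w t

  -- The greatest fixed point of Rule, as the union of all its post-fixed points.

  _⊨C_ : Trace E → Term AP 0 → Set₁
  w ⊨C t = Σ[ R ∈ (Trace E → Term AP 0 → Set) ] (Consistent R × R w t)

  ⟦_⟧C : Term AP 0 → Pred (Trace E) (Level.suc 0ℓ)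
  ⟦ t ⟧C w = w ⊨C t

{-# OPTIONS --safe #-}

-- Γ𝕊 P consists of the traces all of whose finite prefixes extend to a trace in
-- P. For P = ⟦ φ ⟧L, the truth values of the subformulas of φ on a trace w are
-- determined by the atoms of φ that hold of w 0 and by those truth values on
-- suffix w 1. Reading events therefore moves deterministically between the
-- finitely many sets of truth-value vectors: q holds the vectors that the rest of
-- the trace may have for the whole trace to satisfy φ. A trace is in the closure
-- iff every set it passes through is live, that is, contains the vector of some
-- trace. This is a finite deterministic safety automaton, which unravels to a
-- ν-term.

module Submission where

open import Defs
open import Axiom.ExcludedMiddle using (ExcludedMiddle)
open import Data.Bool.Base using (if_then_else_)
open import Data.Fin.Base using (Fin; zero; suc; combine; funToFin; finToFun)
open import Data.Fin.Patterns using (0F; 1F)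
open import Data.Fin.Properties using (_≟_; any?; finToFun-funToFin; injective⇒≤)
open import Data.Fin.Substitution using (Lift; Sub; Subs; Application; TermSubst)
open import Data.Fin.Substitution.Lemmas using (TermLemmas)
open import Data.List.Base using (List; []; _∷_; _++_; length; lookup)
open import Data.List.Membership.Propositional.Properties using (∈-lookup)
open import Data.List.Properties using (∷-injective)
open import Data.List.Relation.Unary.All as All using (All; []; _∷_)
open import Data.List.Relation.Unary.All.Properties using (++⁺; ++⁻)
open import Data.List.Relation.Unary.Any as Any using ()
open import Data.List.Relation.Unary.Any.Properties using (lookup-index)
open import Data.Nat.Base using (ℕ; zero; suc; _+_; _^_; _≤_; z≤n; s≤s; z<s)
open import Data.Nat.Properties using (+-suc; 1+n≰n; m≤m+n; ≤-trans)
open import Data.Product.Base as Product using (_×_; _,_; proj₁; proj₂; ∃-syntax)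
open import Data.Sum.Base as Sum using (_⊎_; inj₁; inj₂)
open import Data.Vec.Base as Vec using (Vec; []; _∷_)
open import Function.Base using (_∘_; id)
open import Function.Bundles using (_⇔_; mk⇔; module Equivalence)
open import Function.Definitions using (Injective)
open import Level using (0ℓ)
open import Relation.Binary.Construct.Closure.ReflexiveTransitive using (ε; _◅_; _▻_)
open import Relation.Binary.PropositionalEquality
  using (_≡_; _≗_; refl; sym; trans; cong; cong₂; subst)
open import Relation.Nullary using (¬_; Dec; yes; no; does; contradiction)
open import Relation.Nullary.Decidable using (decidable-stable)
open import Relation.Unary using (Pred; _∈_; _∉_; _⊆_; _≐_; _∩_; ∁; U)

open Equivalence using (to; from)

private
  variable
    E AP : Set
    k m n : ℕ

-- Substitution in terms

module _ {T : ℕ → Set} {l : Lift T (Term AP)} where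
  open TermApp l using (_/_)
  open Lift l using (_↑✶_)

  application : Application (Term AP) T
  application = record { _/_ = _/_ }

  open Application application using (_/✶_)

  -- Iterated substitution does not compute on an abstract sequence, so commutation with each
  -- constructor goes by induction on the sequence. These facts feed `/✶-↑✶`.
  ⊤-/✶ : ∀ k (ρs : Subs T m n) → ⊤ /✶ ρs ↑✶ k ≡ ⊤
  ⊤-/✶ k ε        = refl
  ⊤-/✶ k (ρ ◅ ρs) = cong (_/ _) (⊤-/✶ k ρs)

  ⊥-/✶ : ∀ k (ρs : Subs T m n) → ⊥ /✶ ρs ↑✶ k ≡ ⊥
  ⊥-/✶ k ε        = refl
  ⊥-/✶ k (ρ ◅ ρs) = cong (_/ _) (⊥-/✶ k ρs)

  atom-/✶ : ∀ k p (ρs : Subs T m n) → atom p /✶ ρs ↑✶ k ≡ atom p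
  atom-/✶ k p ε        = refl
  atom-/✶ k p (ρ ◅ ρs) = cong (_/ _) (atom-/✶ k p ρs)

  ᗮ-/✶ : ∀ k p (ρs : Subs T m n) → (p ᗮ) /✶ ρs ↑✶ k ≡ p ᗮ
  ᗮ-/✶ k p ε        = refl
  ᗮ-/✶ k p (ρ ◅ ρs) = cong (_/ _) (ᗮ-/✶ k p ρs)

  ∧-/✶ : ∀ k {t s} (ρs : Subs T m n) →
         (t ∧ s) /✶ ρs ↑✶ k ≡ (t /✶ ρs ↑✶ k) ∧ (s /✶ ρs ↑✶ k)
  ∧-/✶ k ε        = refl
  ∧-/✶ k (ρ ◅ ρs) = cong (_/ _) (∧-/✶ k ρs)

  ∨-/✶ : ∀ k {t s} (ρs : Subs T m n) →
         (t ∨ s) /✶ ρs ↑✶ k ≡ (t /✶ ρs ↑✶ k) ∨ (s /✶ ρs ↑✶ k)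
  ∨-/✶ k ε        = refl
  ∨-/✶ k (ρ ◅ ρs) = cong (_/ _) (∨-/✶ k ρs)

  ○-/✶ : ∀ k {t} (ρs : Subs T m n) → (○ t) /✶ ρs ↑✶ k ≡ ○ (t /✶ ρs ↑✶ k)
  ○-/✶ k ε        = refl
  ○-/✶ k (ρ ◅ ρs) = cong (_/ _) (○-/✶ k ρs)

  ν-/✶ : ∀ k {t} (ρs : Subs T m n) → ν t /✶ ρs ↑✶ k ≡ ν (t /✶ ρs ↑✶ suc k)
  ν-/✶ k ε        = refl
  ν-/✶ k (ρ ◅ ρs) = cong (_/ _) (ν-/✶ k ρs)

termLemmas : TermLemmas (Term AP)
termLemmas {AP} = record
  { termSubst = termSubst
  ; app-var   = refl
  ; /✶-↑✶     = Lemma./✶-↑✶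
  }
  where
  module Lemma {T₁ T₂ : ℕ → Set} {l₁ : Lift T₁ (Term AP)} {l₂ : Lift T₂ (Term AP)} where
    open TermSubst (termSubst {AP}) using (module Lifted)
    open Lifted l₁ using () renaming (_↑✶_ to _↑✶₁_; _/✶_ to _/✶₁_)
    open Lifted l₂ using () renaming (_↑✶_ to _↑✶₂_; _/✶_ to _/✶₂_)

    /✶-↑✶ : ∀ {m n} (ρs₁ : Subs T₁ m n) (ρs₂ : Subs T₂ m n) →
            (∀ k x → var x /✶₁ ρs₁ ↑✶₁ k ≡ var x /✶₂ ρs₂ ↑✶₂ k) →
            ∀ k t → t /✶₁ ρs₁ ↑✶₁ k ≡ t /✶₂ ρs₂ ↑✶₂ k
    /✶-↑✶ ρs₁ ρs₂ hyp = go
      where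
      go : ∀ k t → t /✶₁ ρs₁ ↑✶₁ k ≡ t /✶₂ ρs₂ ↑✶₂ k
      go k ⊤        = trans (⊤-/✶ k ρs₁) (sym (⊤-/✶ k ρs₂))
      go k ⊥        = trans (⊥-/✶ k ρs₁) (sym (⊥-/✶ k ρs₂))
      go k (atom p) = trans (atom-/✶ k p ρs₁) (sym (atom-/✶ k p ρs₂))
      go k (p ᗮ)    = trans (ᗮ-/✶ k p ρs₁) (sym (ᗮ-/✶ k p ρs₂))
      go k (t ∧ s)  = trans (∧-/✶ k ρs₁)
        (trans (cong₂ _∧_ (go k t) (go k s)) (sym (∧-/✶ k ρs₂)))
      go k (t ∨ s)  = trans (∨-/✶ k ρs₁)
        (trans (cong₂ _∨_ (go k t) (go k s)) (sym (∨-/✶ k ρs₂)))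
      go k (○ t)    = trans (○-/✶ k ρs₁) (trans (cong ○_ (go k t)) (sym (○-/✶ k ρs₂)))
      go k (var x)  = hyp k x
      go k (ν t)    = trans (ν-/✶ k ρs₁) (trans (cong ν (go (suc k) t)) (sym (ν-/✶ k ρs₂)))

module _ {AP : Set} where
  open TermLemmas (termLemmas {AP}) public using (_/_; _↑; map-weaken-⊙-sub; ⨀→/✶)

-- On the variables other than zero, substituting `s` undoes the weakening in `σ ↑`. Hence unrolling
-- a `ν` under an environment only extends that environment.
/-↑-[] : (t : Term AP (suc m)) (s : Term AP n) (σ : Sub (Term AP) m n) →
         (t / σ ↑) [ s ] ≡ t / (s ∷ σ)
/-↑-[] t s σ = ⨀→/✶ (ε ▻ σ ↑ ▻ (s ∷ _)) (ε ▻ (s ∷ σ)) (cong (s ∷_) map-weaken-⊙-sub) t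

-- Membership of finite sets coded by numbers

module FiniteSets (em : ExcludedMiddle 0ℓ) where

  indicator : Set → Fin 2
  indicator A = if does (em {A}) then 1F else 0F

  indicator⁺ : ∀ {A} → A → indicator A ≡ 1F
  indicator⁺ {A} a with em {A}
  ... | yes _ = refl
  ... | no ¬a = contradiction a ¬a

  indicator⁻ : ∀ {A} → indicator A ≡ 1F → A
  indicator⁻ {A} eq with em {A}
  indicator⁻ eq | yes a = a

  indicator-cong : ∀ {A B} → A ⇔ B → indicator A ≡ indicator B
  indicator-cong {A} {B} A⇔B with em {A} | em {B}
  ... | yes _ | yes _ = refl
  ... | yes a | no ¬b = contradiction (to A⇔B a) ¬b
  ... | no ¬a | yes b = contradiction (from A⇔B b) ¬a
  ... | no _  | no _  = refl

  -- Coding a set by a number makes it an index in turn: sets of sets have codes too, and equality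
  -- of codes is decidable.
  encode : Pred (Fin m) 0ℓ → Fin (2 ^ m)
  encode P = funToFin (indicator ∘ P)

  infix 4 _∈ᶜ_

  _∈ᶜ_ : Fin m → Fin (2 ^ m) → Set
  i ∈ᶜ c = finToFun c i ≡ 1F

  ∈-encode⁺ : (P : Pred (Fin m) 0ℓ) → ∀ {i} → P i → i ∈ᶜ encode P
  ∈-encode⁺ P p = trans (finToFun-funToFin (indicator ∘ P) _) (indicator⁺ p)

  ∈-encode⁻ : (P : Pred (Fin m) 0ℓ) → ∀ {i} → i ∈ᶜ encode P → P i
  ∈-encode⁻ P p = indicator⁻ (trans (sym (finToFun-funToFin (indicator ∘ P) _)) p)

  funToFin-cong : {f g : Fin m → Fin n} → f ≗ g → funToFin f ≡ funToFin g
  funToFin-cong {m = zero}  f≗g = refl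
  funToFin-cong {m = suc m} f≗g = cong₂ combine (f≗g zero) (funToFin-cong (f≗g ∘ suc))

  encode-cong : {P Q : Pred (Fin m) 0ℓ} → (∀ i → P i ⇔ Q i) → encode P ≡ encode Q
  encode-cong P⇔Q = funToFin-cong (indicator-cong ∘ P⇔Q)

-- Deterministic safety automata as terms

module _ {E AP : Set} (⟪_⟫ : AP → Pred E 0ℓ) where
  open Semantics ⟪_⟫

  -- Uniform sets of events are the letters read by the automaton.
  Uniform : List AP → Pred E 0ℓ → Set
  Uniform ps C = ∀ {d e} → d ∈ C → e ∈ C → All (λ p → d ∈ ⟪ p ⟫ → e ∈ ⟪ p ⟫) ps

  -- A decision tree on the atoms in `ps`. Along a branch `C` collects the events that fit the
  -- answers so far, so the continuation at a leaf knows which letter was read.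
  readLetter : List AP → Pred E 0ℓ → (Pred E 0ℓ → Term AP n) → Term AP n
  readLetter []       C f = f C
  readLetter (p ∷ ps) C f =
    (atom p ∧ readLetter ps (C ∩ ⟪ p ⟫) f) ∨ (p ᗮ ∧ readLetter ps (C ∩ ∁ ⟪ p ⟫) f)

  readLetter-/ : ∀ ps C (f : Pred E 0ℓ → Term AP m) (σ : Sub (Term AP) m n) →
                 readLetter ps C f / σ ≡ readLetter ps C (λ D → f D / σ)
  readLetter-/ []       C f σ = refl
  readLetter-/ (p ∷ ps) C f σ = cong₂ (λ t s → (atom p ∧ t) ∨ (p ᗮ ∧ s))
    (readLetter-/ ps (C ∩ ⟪ p ⟫) f σ) (readLetter-/ ps (C ∩ ∁ ⟪ p ⟫) f σ)

  -- Finite derivations with leaves in `R`: one transition of the automaton takes several rules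
  -- before it meets `R` again.
  data Closure (R : Trace E → Term AP 0 → Set) (w : Trace E) (t : Term AP 0) : Set where
    base : R w t → Closure R w t
    rule : Rule (Closure R) w t → Closure R w t

  -- Coinduction up to finite derivations.
  coinduction : ∀ {R} → (∀ {w t} → R w t → Rule (Closure R) w t) →
                ∀ {w t} → R w t → w ⊨C t
  coinduction {R} step r = Closure R , consistent , base r
    where
    consistent : Consistent (Closure R)
    consistent (base r) = step r
    consistent (rule d) = d

  ⊨C-ν⁻ : ∀ {w t} → w ⊨C ν t → w ⊨C t [ ν t ]
  ⊨C-ν⁻ (R , con , r) with ν-rule r′ ← con r = R , con , r′

  ⊨C-○⁻ : ∀ {w t} → w ⊨C ○ t → suffix w 1 ⊨C t
  ⊨C-○⁻ (R , con , r) with ○-rule r′ ← con r = R , con , r′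

  ⊨C-∧⁻ : ∀ {w t s} → w ⊨C t ∧ s → w ⊨C t × w ⊨C s
  ⊨C-∧⁻ (R , con , r) with ∧-rule r₁ r₂ ← con r = (R , con , r₁) , (R , con , r₂)

  ⊨C-∨⁻ : ∀ {w t s} → w ⊨C t ∨ s → w ⊨C t ⊎ w ⊨C s
  ⊨C-∨⁻ (R , con , r) with con r
  ... | ∨-ruleˡ r′ = inj₁ (R , con , r′)
  ... | ∨-ruleʳ r′ = inj₂ (R , con , r′)

  ⊨C-atom⁻ : ∀ {w p} → w ⊨C atom p → w 0 ∈ ⟪ p ⟫
  ⊨C-atom⁻ (R , con , r) with atom-rule w₀∈p ← con r = w₀∈p

  ⊨C-ᗮ⁻ : ∀ {w p} → w ⊨C p ᗮ → w 0 ∉ ⟪ p ⟫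
  ⊨C-ᗮ⁻ (R , con , r) with ᗮ-rule w₀∉p ← con r = w₀∉p

  ⊨C-⊥⁻ : ∀ {w} → ¬ w ⊨C ⊥
  ⊨C-⊥⁻ (R , con , r) with () ← con r

  -- The derivation selects one branch. Its answers hold for all events of the leaf's set, because
  -- `D ⊆ C` carries each restriction down to the leaf; this gives uniformity.
  ⊨C-readLetter⁻ : ∀ ps C f {w} → w 0 ∈ C → w ⊨C readLetter ps C f →
                   ∃[ D ] (D ⊆ C × w 0 ∈ D × Uniform ps D × w ⊨C f D)
  ⊨C-readLetter⁻ []       C f w₀∈C w⊨ = C , id , w₀∈C , (λ _ _ → []) , w⊨
  ⊨C-readLetter⁻ (p ∷ ps) C f w₀∈C w⊨ with ⊨C-∨⁻ w⊨
  ... | inj₁ w⊨ˡ =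
    let w⊨p , w⊨′ = ⊨C-∧⁻ w⊨ˡ
        D , D⊆ , w₀∈D , uni , w⊨f = ⊨C-readLetter⁻ ps (C ∩ ⟪ p ⟫) f (w₀∈C , ⊨C-atom⁻ w⊨p) w⊨′
    in D , proj₁ ∘ D⊆ , w₀∈D ,
       (λ d∈D e∈D → (λ _ → proj₂ (D⊆ e∈D)) ∷ uni d∈D e∈D) , w⊨f
  ... | inj₂ w⊨ʳ =
    let w⊨p , w⊨′ = ⊨C-∧⁻ w⊨ʳ
        D , D⊆ , w₀∈D , uni , w⊨f = ⊨C-readLetter⁻ ps (C ∩ ∁ ⟪ p ⟫) f (w₀∈C , ⊨C-ᗮ⁻ w⊨p) w⊨′
    in D , proj₁ ∘ D⊆ , w₀∈D ,
       (λ d∈D e∈D → (λ d∈p → contradiction d∈p (proj₂ (D⊆ d∈D))) ∷ uni d∈D e∈D) , w⊨f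

  -- Unravelling a finite automaton into a `ν`-term

  module Unravelling (em : ExcludedMiddle 0ℓ) (ps : List AP) {N : ℕ}
                     {Live : Pred (Fin N) 0ℓ} (live? : ∀ q → Dec (Live q))
                     (δ : Fin N → Pred E 0ℓ → Fin N) where

    -- A dead state becomes `⊥`, which has no rule, so no run can pass through it.
    guard : {A : Set} → Dec A → Term AP n → Term AP n
    guard (yes _) t = t
    guard (no _)  t = ⊥

    guard-/ : {A : Set} (A? : Dec A) (t : Term AP m) (σ : Sub (Term AP) m n) →
              guard A? t / σ ≡ guard A? (t / σ)
    guard-/ (yes _) t σ = refl
    guard-/ (no _)  t σ = refl

    ⊨C-guard⁻ : ∀ {A} (A? : Dec A) {t w} → w ⊨C guard A? t → A × w ⊨C t
    ⊨C-guard⁻ (yes a) w⊨ = a , w⊨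
    ⊨C-guard⁻ (no _)  w⊨ = contradiction w⊨ ⊨C-⊥⁻

    body : (Pred E 0ℓ → Term AP n) → Fin N → Term AP n
    body f q = guard (live? q) (readLetter ps U (○_ ∘ f))

    body-/ : ∀ f q (σ : Sub (Term AP) m n) → body f q / σ ≡ body (λ C → f C / σ) q
    body-/ f q σ = trans (guard-/ (live? q) _ σ)
                         (cong (guard (live? q)) (readLetter-/ ps U _ σ))

    -- The automaton is unravelled into a tree, and a state already met on the
    -- branch becomes the variable bound where it was met. The states on a branch
    -- are distinct, so the fuel k is never exhausted when N ≤ k + n.

    tree : ℕ → Vec (Fin N) n → Fin N → Term AP n
    node : ℕ → (qs : Vec (Fin N) n) (q : Fin N) → Dec (∃[ i ] q ≡ Vec.lookup qs i) → Term AP n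

    tree k qs q = node k qs q (any? λ i → q ≟ Vec.lookup qs i)

    node k       qs q (yes (i , _)) = var i
    node zero    qs q (no _)        = ⊥
    node (suc k) qs q (no _)        = ν (body (λ C → tree k (q ∷ qs) (δ q C)) q)

    -- The closed instances of subtrees: each branch variable is replaced by a term that represents
    -- the state it stands for. The other two premises are the invariants that keep the fuel from
    -- running out.
    data Represents : Term AP 0 → Fin N → Set where
      closed : {qs : Vec (Fin N) n} {σ : Sub (Term AP) n 0} →
               Injective _≡_ _≡_ (Vec.lookup qs) → N ≤ k + n →
               (∀ i → Represents (Vec.lookup σ i) (Vec.lookup qs i)) →
               ∀ q → Represents (tree k qs q / σ) q

    ∷-lookup-injective : ∀ q (qs : Vec (Fin N) n) →
                         ¬ (∃[ i ] q ≡ Vec.lookup qs i) → Injective _≡_ _≡_ (Vec.lookup qs) →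
                         Injective _≡_ _≡_ (Vec.lookup (q ∷ qs))
    ∷-lookup-injective _ _ q∉ inj {zero}  {zero}  eq = refl
    ∷-lookup-injective _ _ q∉ inj {zero}  {suc j} eq = contradiction (j , eq) q∉
    ∷-lookup-injective _ _ q∉ inj {suc i} {zero}  eq = contradiction (i , sym eq) q∉
    ∷-lookup-injective _ _ q∉ inj {suc i} {suc j} eq = cong suc (inj eq)

    Unfolds : Term AP 0 → Fin N → Set₁
    Unfolds t q = ∃[ s ] ∃[ f ]
      (t ≡ ν s × s [ ν s ] ≡ body f q × (∀ C → Represents (f C) (δ q C)))

    -- A variable leads through `σ` to another term for the same state, and this chase ends because
    -- `Represents` is inductive. At a fresh state the term is a `ν`; unrolling it extends `σ` by
    -- the term itself, which represents the state just pushed onto the branch.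
    unfold : ∀ {t q} → Represents t q → Unfolds t q
    unfold r@(closed {k = k} {qs = qs} {σ} inj N≤ σ-rep q) =
      -- The membership test becomes an argument to match on; `r` goes along so that it can serve
      -- for variable zero in the fresh case.
      go k {qs = qs} {σ} inj N≤ σ-rep q (any? λ i → q ≟ Vec.lookup qs i) r
      where
      go : ∀ k {n} {qs : Vec (Fin N) n} {σ : Sub (Term AP) n 0} →
           Injective _≡_ _≡_ (Vec.lookup qs) → N ≤ k + n →
           (∀ i → Represents (Vec.lookup σ i) (Vec.lookup qs i)) →
           ∀ q d → Represents (node k qs q d / σ) q → Unfolds (node k qs q d / σ) q
      go k       inj N≤ σ-rep q (yes (i , refl)) r = unfold (σ-rep i)
      -- Without fuel `N ≤ n`, yet `q ∷ qs` would list `suc n` distinct elements of `Fin N`.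
      go zero {qs = qs} inj N≤ σ-rep q (no q∉)   r =
        contradiction (≤-trans (injective⇒≤ (∷-lookup-injective q qs q∉ inj)) N≤) 1+n≰n
      go (suc k) {n} {qs} {σ} inj N≤ σ-rep q (no q∉) r =
        _ , _ , refl , trans (/-↑-[] (body _ q) _ σ) (body-/ _ q (_ ∷ σ)) ,
        λ C → closed (∷-lookup-injective q _ q∉ inj) (subst (N ≤_) (sym (+-suc k n)) N≤)
                (λ { zero → r ; (suc i) → σ-rep i }) (δ q C)

    term : Fin N → Term AP 0
    term q = tree N [] q / []

    term-represents : ∀ q → Represents (term q) q
    term-represents = closed {k = N} {qs = []} {[]} (λ { {()} }) (m≤m+n N 0) λ ()

    ⊨C⇒step : ∀ {t q w} → Represents t q → w ⊨C t → Live q ×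
      (∃[ C ] (w 0 ∈ C × Uniform ps C × ∃[ t′ ] (Represents t′ (δ q C) × suffix w 1 ⊨C t′)))
    ⊨C⇒step {q = q} {w} r w⊨ with s , f , refl , eq , reps ← unfold r =
      let lq , w⊨r = ⊨C-guard⁻ (live? q) (subst (w ⊨C_) eq (⊨C-ν⁻ w⊨))
          C , _ , w₀∈C , uni , w⊨f = ⊨C-readLetter⁻ ps U (○_ ∘ f) _ w⊨r
      in lq , C , w₀∈C , uni , f C , reps C , ⊨C-○⁻ w⊨f

    module _ (G : Trace E → Fin N → Set) (G⇒Live : ∀ {w q} → G w q → Live q)
             (G-δ : ∀ {w q} C → w 0 ∈ C → G w q → G (suffix w 1) (δ q C)) where

      private
        R : Trace E → Term AP 0 → Set
        R w t = ∃[ q ] (Represents t q × G w q)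

      Closure-readLetter : ∀ ps C f {w} → w 0 ∈ C → (∀ D → w 0 ∈ D → Closure R w (f D)) →
                           Closure R w (readLetter ps C f)
      Closure-readLetter []       C f w₀∈C h = h C w₀∈C
      Closure-readLetter (p ∷ ps) C f {w} w₀∈C h with em {w 0 ∈ ⟪ p ⟫}
      ... | yes w₀∈p = rule (∨-ruleˡ (rule (∧-rule (rule (atom-rule w₀∈p))
                         (Closure-readLetter ps _ f (w₀∈C , w₀∈p) h))))
      ... | no  w₀∉p = rule (∨-ruleʳ (rule (∧-rule (rule (ᗮ-rule w₀∉p))
                         (Closure-readLetter ps _ f (w₀∈C , w₀∉p) h))))

      Closure-guard : ∀ {A} (A? : Dec A) {t w} → A → Closure R w t → Closure R w (guard A? t)
      Closure-guard (yes _) a c = c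
      Closure-guard (no ¬a) a c = contradiction a ¬a

      -- Unrolling, passing the guard and reading the first event form a finite derivation whose
      -- open leaf is again related by `G`, so coinduction up to finite derivations applies.
      G⇒⊨C : ∀ {t q w} → Represents t q → G w q → w ⊨C t
      G⇒⊨C r g = coinduction step (_ , r , g)
        where
        step : ∀ {w t} → R w t → Rule (Closure R) w t
        step {w} (q , r , g) with s , f , refl , eq , reps ← unfold r =
          ν-rule (subst (Closure R w) (sym eq) (Closure-guard (live? q) (G⇒Live g)
            (Closure-readLetter ps U _ _ λ C w₀∈C →
              rule (○-rule (base (δ q C , reps C , G-δ C w₀∈C g))))))

-- Adherence

module _ {E : Set} where

  -- The topological closure of `P`, with basic open sets given by finite prefixes.
  Adherence : Property E → Property E
  Adherence P w = ∀ u → u isPrefixOf w → ∃[ w′ ] (u isPrefixOf w′ × w′ ∈ P)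

  -- The adherence is a safety property containing `P`, hence one of the sets intersected.
  -- Conversely, a safety property that contains `P` but not `w` would forbid a prefix of `w` that
  -- some trace of `P` has.
  Γ𝕊≐Adherence : ExcludedMiddle 0ℓ → (P : Property E) → Γ𝕊 P ≐ Adherence P
  Γ𝕊≐Adherence em P =
    (λ w∈Γ → w∈Γ (Adherence P) safety (λ {w} w∈P u u≤w → w , u≤w , w∈P)) ,
    (λ {w} w∈cl Q Q-safe P⊆Q → decidable-stable em λ w∉Q →
      let u , u≤w , bad     = Q-safe w w∉Q
          w′ , u≤w′ , w′∈P = w∈cl u u≤w
      in bad w′ u≤w′ (P⊆Q w′∈P))
    where
    safety : Safety (Adherence P)
    safety w w∉cl = decidable-stable em λ noBad → w∉cl λ u u≤w →
      decidable-stable em λ noExt →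
        noBad (u , u≤w , λ w′ u≤w′ w′∈cl → noExt (w′∈cl u u≤w′))

-- Truth values of subformulas

module _ {AP : Set} where

  -- `φ` heads its own list, so `All.head` reads off its truth value.
  subformulas properSubformulas : LTL AP → List (LTL AP)
  subformulas φ = φ ∷ properSubformulas φ
  properSubformulas ⊤        = []
  properSubformulas ⊥        = []
  properSubformulas (atom p) = []
  properSubformulas (p ᗮ)    = []
  properSubformulas (φ ∧ ψ)  = subformulas φ ++ subformulas ψ
  properSubformulas (φ ∨ ψ)  = subformulas φ ++ subformulas ψ
  properSubformulas (φ 𝓤 ψ)  = subformulas φ ++ subformulas ψ
  properSubformulas (φ 𝓡 ψ)  = subformulas φ ++ subformulas ψ
  properSubformulas (○ φ)    = subformulas φ

  atoms : LTL AP → List AP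
  atoms ⊤        = []
  atoms ⊥        = []
  atoms (atom p) = p ∷ []
  atoms (p ᗮ)    = p ∷ []
  atoms (φ ∧ ψ)  = atoms φ ++ atoms ψ
  atoms (φ ∨ ψ)  = atoms φ ++ atoms ψ
  atoms (φ 𝓤 ψ)  = atoms φ ++ atoms ψ
  atoms (φ 𝓡 ψ)  = atoms φ ++ atoms ψ
  atoms (○ φ)    = atoms φ

-- One-step unfolding of the LTL semantics

module _ {E AP : Set} (⟪_⟫ : AP → Pred E 0ℓ) where
  open Semantics ⟪_⟫

  ⊨L-suffix : ∀ φ {w i} → w ⊨L[ suc i ] φ ⇔ suffix w 1 ⊨L[ i ] φ
  ⊨L-suffix ⊤        = mk⇔ id id
  ⊨L-suffix ⊥        = mk⇔ id id
  ⊨L-suffix (atom p) = mk⇔ id id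
  ⊨L-suffix (p ᗮ)    = mk⇔ id id
  ⊨L-suffix (φ ∧ ψ)  = mk⇔ (Product.map (to (⊨L-suffix φ)) (to (⊨L-suffix ψ)))
                           (Product.map (from (⊨L-suffix φ)) (from (⊨L-suffix ψ)))
  ⊨L-suffix (φ ∨ ψ)  = mk⇔ (Sum.map (to (⊨L-suffix φ)) (to (⊨L-suffix ψ)))
                           (Sum.map (from (⊨L-suffix φ)) (from (⊨L-suffix ψ)))
  ⊨L-suffix (φ 𝓤 ψ)  = mk⇔
    (λ { (suc k , s≤s i≤k , ψₖ , φₗ) → k , i≤k , to (⊨L-suffix ψ) ψₖ ,
           λ l i≤l l<k → to (⊨L-suffix φ) (φₗ (suc l) (s≤s i≤l) (s≤s l<k)) })
    (λ { (k , i≤k , ψₖ , φₗ) → suc k , s≤s i≤k , from (⊨L-suffix ψ) ψₖ ,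
           λ { (suc l) (s≤s i≤l) (s≤s l<k) → from (⊨L-suffix φ) (φₗ l i≤l l<k) } })
  ⊨L-suffix (φ 𝓡 ψ)  = mk⇔
    (λ { (inj₁ ψₗ) → inj₁ λ k i≤k → to (⊨L-suffix ψ) (ψₗ (suc k) (s≤s i≤k))
       ; (inj₂ (suc k , s≤s i≤k , φₖ , ψₗ)) → inj₂ (k , i≤k , to (⊨L-suffix φ) φₖ ,
           λ l i≤l l≤k → to (⊨L-suffix ψ) (ψₗ (suc l) (s≤s i≤l) (s≤s l≤k))) })
    (λ { (inj₁ ψₗ) → inj₁ λ { (suc k) (s≤s i≤k) → from (⊨L-suffix ψ) (ψₗ k i≤k) }
       ; (inj₂ (k , i≤k , φₖ , ψₗ)) → inj₂ (suc k , s≤s i≤k , from (⊨L-suffix φ) φₖ ,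
           λ { (suc l) (s≤s i≤l) (s≤s l≤k) → from (⊨L-suffix ψ) (ψₗ l i≤l l≤k) }) })
  ⊨L-suffix (○ φ)    = ⊨L-suffix φ

  -- The split is on whether the witness is position 0; a later witness still serves from position
  -- 1.
  𝓤-expand : ∀ φ ψ {w} →
             w ⊨L[ 0 ] φ 𝓤 ψ ⇔ (w ⊨L[ 0 ] ψ ⊎ (w ⊨L[ 0 ] φ × w ⊨L[ 1 ] φ 𝓤 ψ))
  𝓤-expand φ ψ = mk⇔
    (λ { (zero , _ , ψ₀ , _) → inj₁ ψ₀
       ; (suc k , _ , ψₖ , φₗ) → inj₂ (φₗ 0 z≤n z<s ,
           suc k , s≤s z≤n , ψₖ , λ l _ → φₗ l z≤n) })
    (λ { (inj₁ ψ₀) → 0 , z≤n , ψ₀ , λ _ _ ()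
       ; (inj₂ (φ₀ , k , _ , ψₖ , φₗ)) → k , z≤n , ψₖ ,
           λ { zero _ _ → φ₀ ; (suc l) _ → φₗ (suc l) (s≤s z≤n) } })

  𝓡-expand : ∀ φ ψ {w} →
             w ⊨L[ 0 ] φ 𝓡 ψ ⇔ (w ⊨L[ 0 ] ψ × (w ⊨L[ 0 ] φ ⊎ w ⊨L[ 1 ] φ 𝓡 ψ))
  𝓡-expand φ ψ = mk⇔
    (λ { (inj₁ ψₗ) → ψₗ 0 z≤n , inj₂ (inj₁ λ k _ → ψₗ k z≤n)
       ; (inj₂ (zero , _ , φ₀ , ψₗ)) → ψₗ 0 z≤n z≤n , inj₁ φ₀
       ; (inj₂ (suc k , _ , φₖ , ψₗ)) → ψₗ 0 z≤n z≤n ,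
           inj₂ (inj₂ (suc k , s≤s z≤n , φₖ , λ l _ → ψₗ l z≤n)) })
    (λ { (ψ₀ , inj₁ φ₀) → inj₂ (0 , z≤n , φ₀ , λ { zero _ _ → ψ₀ })
       ; (ψ₀ , inj₂ (inj₁ ψₗ)) →
           inj₁ λ { zero _ → ψ₀ ; (suc k) _ → ψₗ (suc k) (s≤s z≤n) }
       ; (ψ₀ , inj₂ (inj₂ (k , _ , φₖ , ψₗ))) → inj₂ (k , z≤n , φₖ ,
           λ { zero _ _ → ψ₀ ; (suc l) _ → ψₗ (suc l) (s≤s z≤n) }) })

  Preserves : LTL AP → Trace E → Trace E → Set
  Preserves φ w w′ = All (λ ψ → w ⊨L[ 0 ] ψ → w′ ⊨L[ 0 ] ψ) (subformulas φ)

  module _ {w w′ : Trace E} where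

    Agree : List AP → Set
    Agree = All (λ p → w 0 ∈ ⟪ p ⟫ ⇔ w′ 0 ∈ ⟪ p ⟫)

    private
      next : ∀ φ → (suffix w 1 ⊨L[ 0 ] φ → suffix w′ 1 ⊨L[ 0 ] φ) → w ⊨L[ 1 ] φ → w′ ⊨L[ 1 ] φ
      next φ h = from (⊨L-suffix φ) ∘ h ∘ to (⊨L-suffix φ)

    -- Each connective is monotone in the present values of its arguments, and by the expansion laws
    -- `𝓤` and `𝓡` are monotone in their own next value. Negation occurs at atoms only, which is why
    -- `Agree` is two-sided while `Preserves` is one-sided.
    Preserves-step : ∀ φ → Agree (atoms φ) → Preserves φ (suffix w 1) (suffix w′ 1) →
                     Preserves φ w w′
    Preserves-step ⊤        _         _  = id ∷ []
    Preserves-step ⊥        _         _  = id ∷ []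
    Preserves-step (atom p) (e ∷ _)   _  = to e ∷ []
    Preserves-step (p ᗮ)    (e ∷ _)   _  = (_∘ from e) ∷ []
    Preserves-step (○ φ)    es (_ ∷ hs)  = next φ (All.head hs) ∷ Preserves-step φ es hs
    Preserves-step (φ ∧ ψ)  es (h ∷ hs)  =
      let e₁ , e₂ = ++⁻ (atoms φ) es
          h₁ , h₂ = ++⁻ (subformulas φ) hs
          g₁ = Preserves-step φ e₁ h₁
          g₂ = Preserves-step ψ e₂ h₂
      in Product.map (All.head g₁) (All.head g₂) ∷ ++⁺ g₁ g₂
    Preserves-step (φ ∨ ψ)  es (h ∷ hs)  =
      let e₁ , e₂ = ++⁻ (atoms φ) es
          h₁ , h₂ = ++⁻ (subformulas φ) hs
          g₁ = Preserves-step φ e₁ h₁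
          g₂ = Preserves-step ψ e₂ h₂
      in Sum.map (All.head g₁) (All.head g₂) ∷ ++⁺ g₁ g₂
    Preserves-step (φ 𝓤 ψ)  es (h ∷ hs)  =
      let e₁ , e₂ = ++⁻ (atoms φ) es
          h₁ , h₂ = ++⁻ (subformulas φ) hs
          g₁ = Preserves-step φ e₁ h₁
          g₂ = Preserves-step ψ e₂ h₂
      in from (𝓤-expand φ ψ) ∘ Sum.map (All.head g₂) (Product.map (All.head g₁) (next (φ 𝓤 ψ) h))
           ∘ to (𝓤-expand φ ψ) ∷ ++⁺ g₁ g₂
    Preserves-step (φ 𝓡 ψ)  es (h ∷ hs)  =
      let e₁ , e₂ = ++⁻ (atoms φ) es
          h₁ , h₂ = ++⁻ (subformulas φ) hs
          g₁ = Preserves-step φ e₁ h₁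
          g₂ = Preserves-step ψ e₂ h₂
      in from (𝓡-expand φ ψ) ∘ Product.map (All.head g₂) (Sum.map (All.head g₁) (next (φ 𝓡 ψ) h))
           ∘ to (𝓡-expand φ ψ) ∷ ++⁺ g₁ g₂

-- The automaton on sets of truth-value vectors

module ClosureTerm (em : ExcludedMiddle 0ℓ) {E AP : Set} (⟪_⟫ : AP → Pred E 0ℓ)
                   (φ : LTL AP) where
  open Semantics ⟪_⟫
  open FiniteSets em

  Holds : Trace E → Pred (Fin (length (subformulas φ))) 0ℓ
  Holds w i = w ⊨L[ 0 ] lookup (subformulas φ) i

  truth : Trace E → Fin (2 ^ length (subformulas φ))
  truth w = encode (Holds w)

  truth≡⇒Preserves : ∀ {w w′} → truth w ≡ truth w′ → Preserves ⟪_⟫ φ w w′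
  truth≡⇒Preserves {w} {w′} eq = All.tabulate λ ψ∈ →
    let i = Any.index ψ∈ in
    subst (λ ψ → w ⊨L[ 0 ] ψ → w′ ⊨L[ 0 ] ψ) (sym (lookup-index ψ∈))
      (λ ⊨ψ → ∈-encode⁻ (Holds w′) {i} (subst (i ∈ᶜ_) eq (∈-encode⁺ (Holds w) {i} ⊨ψ)))

  Preserves⇒truth≡ : ∀ {w w′} → Preserves ⟪_⟫ φ w w′ → Preserves ⟪_⟫ φ w′ w → truth w ≡ truth w′
  Preserves⇒truth≡ h h′ = encode-cong λ i →
    mk⇔ (All.lookup h (∈-lookup i)) (All.lookup h′ (∈-lookup i))

  -- Uniformity makes the first events agree on the atoms of `φ`, so `Preserves-step` applies in
  -- both directions.
  truth-step : ∀ {C w w′} → Uniform ⟪_⟫ (atoms φ) C → w 0 ∈ C → w′ 0 ∈ C →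
               truth (suffix w 1) ≡ truth (suffix w′ 1) → truth w ≡ truth w′
  truth-step {C} uni w₀∈C w′₀∈C eq = Preserves⇒truth≡
    (Preserves-step ⟪_⟫ φ (agree w₀∈C w′₀∈C) (truth≡⇒Preserves eq))
    (Preserves-step ⟪_⟫ φ (agree w′₀∈C w₀∈C) (truth≡⇒Preserves (sym eq)))
    where
    agree : ∀ {d e} → d ∈ C → e ∈ C → All (λ p → d ∈ ⟪ p ⟫ ⇔ e ∈ ⟪ p ⟫) (atoms φ)
    agree d∈C e∈C = All.zipWith (λ (f , g) → mk⇔ f g) (uni d∈C e∈C , uni e∈C d∈C)

  State : Set
  State = Fin (2 ^ (2 ^ length (subformulas φ)))

  -- Not the traces accepted from `q`: those form the adherence of this set.
  Language : State → Property E
  Language q w = truth w ∈ᶜ q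

  Initial : Pred (Fin _) 0ℓ
  Initial v = ∃[ w ] (w ∈ ⟦ φ ⟧L × truth w ≡ v)

  -- The left quotient of `Language q` by a letter, at the level of vectors.
  Successor : State → Pred E 0ℓ → Pred (Fin _) 0ℓ
  Successor q C v = ∃[ w ] (w ∈ Language q × w 0 ∈ C × truth (suffix w 1) ≡ v)

  initial : State
  initial = encode Initial

  δ : State → Pred E 0ℓ → State
  δ q C = encode (Successor q C)

  Live : Pred State 0ℓ
  Live q = ∃[ w ] w ∈ Language q

  live? : ∀ q → Dec (Live q)
  live? _ = em

  open Unravelling ⟪_⟫ em (atoms φ) live? δ public

  -- Satisfaction of `φ` is an entry of the vector, so it passes between traces with equal vectors.
  Language-initial : Language initial ≐ ⟦ φ ⟧L
  Language-initial =
    (λ w∈ → let w′ , w′⊨φ , eq = ∈-encode⁻ Initial w∈ in All.head (truth≡⇒Preserves eq) w′⊨φ) ,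
    (λ w⊨φ → ∈-encode⁺ Initial (_ , w⊨φ , refl))

  Adherence-δ : ∀ {w q} C → w 0 ∈ C → w ∈ Adherence (Language q) →
                suffix w 1 ∈ Adherence (Language (δ q C))
  -- A prefix `u` of the suffix is tested through the prefix `w 0 ∷ u` of `w`.
  Adherence-δ {w} C w₀∈C w∈cl u u≤w with w∈cl (w 0 ∷ u) (cong (w 0 ∷_) u≤w)
  ... | w′ , eq , w′∈q =
    let w′₀≡w₀ , u≤w′ = ∷-injective eq
    in suffix w′ 1 , u≤w′ ,
       ∈-encode⁺ (Successor _ C) (w′ , w′∈q , subst (_∈ C) (sym w′₀≡w₀) w₀∈C , refl)

  cons : E → Trace E → Trace E
  cons e w zero    = e
  cons e w (suc i) = w i

  -- Induction on the prefix: liveness settles the empty one, and a transition reduces a longer one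
  -- to its tail.
  ⊨C⇒Adherence : ∀ {t q w} → Represents t q → w ⊨C t → w ∈ Adherence (Language q)
  ⊨C⇒Adherence r w⊨ [] _ =
    let (w′ , w′∈q) , _ = ⊨C⇒step r w⊨ in w′ , refl , w′∈q
  ⊨C⇒Adherence {q = q} {w} r w⊨ (e ∷ u) eq =
    let w₀≡e , u≤w = ∷-injective eq
        _ , C , w₀∈C , uni , t′ , r′ , w⊨′ = ⊨C⇒step r w⊨
        x , u≤x , x∈δ = ⊨C⇒Adherence r′ w⊨′ u u≤w
        w′ , w′∈q , w′₀∈C , truth≡ = ∈-encode⁻ (Successor q C) x∈δ
    -- `w′` may start with another event and continue differently, but its head lies in the same
    -- uniform letter as `w 0` and its suffix has the vector of `x`. So `cons (w 0) x` has the
    -- vector of `w′`.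
    in cons (w 0) x , cong₂ _∷_ w₀≡e u≤x ,
       subst (_∈ᶜ q) (truth-step uni w′₀∈C w₀∈C truth≡) w′∈q

  ⟦term⟧C≐Adherence : ∀ q → ⟦ term q ⟧C ≐ Adherence (Language q)
  ⟦term⟧C≐Adherence q =
    ⊨C⇒Adherence (term-represents q) ,
    -- The adherence itself is the coinductive invariant; the empty prefix witnesses liveness.
    G⇒⊨C (λ w q → w ∈ Adherence (Language q))
         (λ w∈cl → let w′ , _ , w′∈q = w∈cl [] refl in w′ , w′∈q)
         Adherence-δ (term-represents q)

Adherence-mono : {P Q : Property E} → P ⊆ Q → Adherence P ⊆ Adherence Q
Adherence-mono P⊆Q w∈cl u u≤w = let w′ , u≤w′ , w′∈P = w∈cl u u≤w in w′ , u≤w′ , P⊆Q w′∈P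

theorem4 : Classical → {E AP : Set} → Countable AP → (⟪_⟫ : AP → Pred E 0ℓ) → let open Semantics ⟪_⟫ in
    (φ : LTL AP) → ∃[ t ] (Γ𝕊 ⟦ φ ⟧L ≐ ⟦ t ⟧C)
theorem4 classical _ ⟪_⟫ φ = term initial ,
  proj₂ (⟦term⟧C≐Adherence initial) ∘ Adherence-mono (proj₂ Language-initial) ∘ proj₁ Γ≐ ,
  proj₂ Γ≐ ∘ Adherence-mono (proj₁ Language-initial) ∘ proj₁ (⟦term⟧C≐Adherence initial)
  where
  open ClosureTerm classical ⟪_⟫ φ
  Γ≐ = Γ𝕊≐Adherence classical (Semantics.⟦_⟧L ⟪_⟫ φ)
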